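{- Let $n$ be a positive integer and $i,j\in\{1,2\}$. (i) If $n$ is odd and $n\ge 17$, then $r(T_n^i,T_n^j)=2n-7$. (ii) If $n$ is even and $n\ge 12$, then $r(T_n^i,T_n^j)=2n-6$.
   Context: All graphs are finite and simple. For graphs $G_1,G_2$, the Ramsey number $r(G_1,G_2)$ is the smallest positive integer $N$ such that for every graph $G$ on $N$ vertices, either $G$ contains a subgraph isomorphic to $G_1$ or the complement $\overline G$ contains a subgraph isomorphic to $G_2$. $T_n^1$ is the tree with vertex set $\{v_0,\ldots,v_{n-1}\}$ and edge set $\{v_0v_1,\ldots,v_0v_{n-3},v_{n-4}v_{n-2},v_{n-3}v_{n-1}\}$; $T_n^2$ is the tree with the same vertex set and edge set $\{v_0v_1,\ldots,v_0v_{n-3},v_{n-3}v_{n-2},v_{n-3}v_{n-1}\}$. -}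

module Defs where

open import Data.Nat using (ℕ; zero; suc; _+_; _∸_; _≤_; _<_)
open import Data.Fin using (Fin; toℕ)
open import Data.Bool using (Bool; true; false)
open import Data.Product using (Σ; _×_; _,_; ∃)
open import Data.Sum using (_⊎_)
open import Relation.Nullary using (¬_)
open import Relation.Binary.PropositionalEquality using (_≡_) renaming (sym to sym≡)
open import Data.Empty using (⊥-elim)
open import Function.Definitions using (Injective)

record Graph (N : ℕ) : Set where
  field
    adj   : Fin N → Fin N → Bool
    symm  : ∀ x y → adj x y ≡ adj y x
    irrefl : ∀ x → adj x x ≡ false
open Graph public

not : Bool → Bool
not true = false
not false = true

complement : ∀ {N} → Graph N → Graph N
complement G = record
  { adj = λ x y → adjC x y
  ; symm = symC
  ; irrefl = irrC
  }
  where
  open import Data.Fin using (_≟_)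
  open import Relation.Nullary using (yes; no)
  open import Relation.Binary.PropositionalEquality using (refl; cong)
  adjC : _ → _ → Bool
  adjC x y with x ≟ y
  ... | yes _ = false
  ... | no _ = not (adj G x y)
  symC : ∀ x y → adjC x y ≡ adjC y x
  symC x y with x ≟ y | y ≟ x
  ... | yes _ | yes _ = refl
  ... | yes p | no q = ⊥-elim (q (sym≡ p))
  ... | no q | yes p = ⊥-elim (q (sym≡ p))
  ... | no _ | no _ = cong not (Graph.symm G x y)
  irrC : ∀ x → adjC x x ≡ false
  irrC x with x ≟ x
  ... | yes _ = refl
  ... | no q = ⊥-elim (q refl)

_⊆ᵍ_ : ∀ {k N} → Graph k → Graph N → Set
_⊆ᵍ_ {k} {N} H G =
  Σ (Fin k → Fin N) λ f → Injective _≡_ _≡_ f ×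
    (∀ x y → adj H x y ≡ true → adj G (f x) (f y) ≡ true)

RamseyHolds : ∀ {a b} → Graph a → Graph b → ℕ → Set
RamseyHolds G₁ G₂ N = (G : Graph N) → (G₁ ⊆ᵍ G) ⊎ (G₂ ⊆ᵍ complement G)

RamseyNumber : ∀ {a b} → Graph a → Graph b → ℕ → Set
RamseyNumber G₁ G₂ m =
  1 ≤ m × RamseyHolds G₁ G₂ m × (∀ N → 1 ≤ N → N < m → ¬ RamseyHolds G₁ G₂ N)

-- Edge sets of T_n^1 and T_n^2 on vertex indices (v_i ↦ i), directed as
-- listed in the paper:
-- T_n^1 : v0 v_k (1 ≤ k ≤ n-3), v_{n-4} v_{n-2}, v_{n-3} v_{n-1}.
-- T_n^2 : v0 v_k (1 ≤ k ≤ n-3), v_{n-3} v_{n-2}, v_{n-3} v_{n-1}.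
open import Data.Nat using (_≟_; _≤?_)
open import Relation.Nullary.Decidable using (⌊_⌋)
open import Data.Bool using (_∧_; _∨_)

isE₁ : ℕ → ℕ → ℕ → Bool
isE₁ n i j =
  (⌊ i ≟ 0 ⌋ ∧ ⌊ 1 ≤? j ⌋ ∧ ⌊ j ≤? n ∸ 3 ⌋) ∨
  (⌊ i ≟ n ∸ 4 ⌋ ∧ ⌊ j ≟ n ∸ 2 ⌋) ∨
  (⌊ i ≟ n ∸ 3 ⌋ ∧ ⌊ j ≟ n ∸ 1 ⌋)

isE₂ : ℕ → ℕ → ℕ → Bool
isE₂ n i j =
  (⌊ i ≟ 0 ⌋ ∧ ⌊ 1 ≤? j ⌋ ∧ ⌊ j ≤? n ∸ 3 ⌋) ∨
  (⌊ i ≟ n ∸ 3 ⌋ ∧ ⌊ j ≟ n ∸ 2 ⌋) ∨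
  (⌊ i ≟ n ∸ 3 ⌋ ∧ ⌊ j ≟ n ∸ 1 ⌋)

-- The simple graph on Fin n with undirected edge set given by a directed
-- edge list e (symmetrised; loops excluded, which never occur for n ≥ 5).
fromEdges : (n : ℕ) → (ℕ → ℕ → Bool) → Graph n
fromEdges n e = record { adj = a ; symm = s ; irrefl = ir }
  where
  open import Data.Fin using () renaming (_≟_ to _≟ᶠ_)
  open import Relation.Nullary using (yes; no)
  open import Relation.Binary.PropositionalEquality using (refl)
  open import Data.Bool.Properties using (∨-comm)
  a : Fin n → Fin n → Bool
  a x y with x ≟ᶠ y
  ... | yes _ = false
  ... | no _ = e (toℕ x) (toℕ y) ∨ e (toℕ y) (toℕ x)
  s : ∀ x y → a x y ≡ a y x
  s x y with x ≟ᶠ y | y ≟ᶠ x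
  ... | yes _ | yes _ = refl
  ... | yes p | no q = ⊥-elim (q (sym≡ p))
  ... | no q | yes p = ⊥-elim (q (sym≡ p))
  ... | no _ | no _ = ∨-comm (e (toℕ x) (toℕ y)) (e (toℕ y) (toℕ x))
  ir : ∀ x → a x x ≡ false
  ir x with x ≟ᶠ x
  ... | yes _ = refl
  ... | no q = ⊥-elim (q refl)

data Idx : Set where one two : Idx

T : (n : ℕ) → Idx → Graph n
T n one = fromEdges n (isE₁ n)
T n two = fromEdges n (isE₂ n)

{-# OPTIONS --safe #-}

-- Put d = n − 3, so that both trees are stars with d leaves and two further vertices hooked onto
-- one or two of the leaves. Colour the pairs in G red and the others blue, on N = 2d − 1 or N = 2d
-- vertices.
-- Upper bound: some vertex v has d neighbours of one colour, say red (for N = 2d − 1 with d even,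
-- otherwise G would be (d − 1)-regular with d − 1 and N odd). Let A be the red neighbourhood of v.
-- If v has at least d + 2 red neighbours and the star cannot be completed, three vertices of A are
-- blue to all but at most four vertices, which gives every blue tree. If it has d or d + 1, failing
-- to hook vertices of B, the rest of the graph, leaves the pairs between A and B almost all blue.
-- Then some b in B has d − 1 blue neighbours in A; with v, which is blue to B, as the d-th leaf,
-- the hooked vertices are found in B.
-- Lower bound: two red cliques of size d − 1 (N = 2d − 2), and for odd d a (d − 1)-regular
-- graph on 2d − 1 vertices.
module Submission where

open import Defs
import Data.Nat as ℕ
open import Data.Nat using (ℕ; zero; suc; _+_; _*_; _∸_; _≤_; _<_; z≤n; s≤s; s≤s⁻¹)
open import Data.Nat.Properties hiding (suc-injective)
open import Data.Fin using (Fin; zero; suc; toℕ; inject₁; #_)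
import Data.Fin as Fin
open import Data.Fin.Properties using (toℕ<n; toℕ-injective; toℕ-inject₁; inject₁-injective; suc-injective; any?; all?)
open import Data.Bool using (Bool; true; false; _∨_; _∧_)
import Data.Bool as Bool
open import Data.List using (List; []; _∷_; _++_; length; filter; allFin; tabulate; map; take; concatMap; applyUpTo)
open import Data.List.Properties using (length-++; length-map; length-tabulate; length-take; length-applyUpTo)
open import Data.List.Membership.Propositional using (_∈_; _∉_)
open import Data.List.Membership.Propositional.Properties
open import Data.List.Relation.Binary.Subset.Propositional using (_⊆_)
open import Data.List.Relation.Unary.All as All using (All; []; _∷_)
open import Data.List.Relation.Unary.Any using (here; there)
open import Data.List.Relation.Unary.AllPairs using ([]; _∷_)
open import Data.List.Relation.Unary.Unique.Propositional using (Unique)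
import Data.List.Relation.Unary.Unique.Propositional.Properties as Unique
open import Data.Product using (∃; ∃₂; _×_; _,_; proj₁; proj₂)
import Data.Sum as Sum
open import Data.Sum using (_⊎_; inj₁; inj₂; map₂)
open import Data.Empty using (⊥; ⊥-elim)
open import Relation.Nullary using (¬_; Dec; yes; no)
open import Relation.Nullary.Decidable using (⌊_⌋; ¬?; _×-dec_; _⊎-dec_; _→-dec_; decidable-stable; from-yes; from-no)
open import Relation.Unary using (Decidable)
open import Relation.Binary.PropositionalEquality
open import Function using (_∘_; id; case_of_)
open import Function.Definitions using (Injective)
open import Data.Fin.Patterns using (0F; 1F; 2F; 3F; 4F)
open import Data.Nat.Divisibility using (_∣_; _∣?_; divides; ∣m∣n⇒∣m+n; ∣m+n∣m⇒∣n; m∣m*n)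
open import Data.Nat.Primality using (euclidsLemma; prime[2])
open import Algebra.Properties.CommutativeMonoid.Sum +-0-commutativeMonoid using (sum; sum-cong-≗; ∑-distrib-+)
open import Data.Nat.ListAction using () renaming (sum to sumˡ)

-- Counting with repetition-free lists.

-- The pigeonhole behind the cardinality bounds below. Only the smaller list must be free of
-- repetitions, so a cover `ys` may be given with overlaps.
unique⊆⇒length≤ : ∀ {A : Set} {xs ys : List A} → Unique xs → xs ⊆ ys → length xs ≤ length ys
unique⊆⇒length≤ {xs = []} _ _ = z≤n
unique⊆⇒length≤ {xs = x ∷ xs} (x# ∷ xs!) sub with ∈-∃++ (sub (here refl))
... | us , vs , refl = begin
  suc (length xs)               ≤⟨ s≤s (unique⊆⇒length≤ xs! delete) ⟩
  suc (length (us ++ vs))       ≡⟨ cong suc (length-++ us) ⟩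
  suc (length us + length vs)   ≡⟨ sym (+-suc (length us) (length vs)) ⟩
  length us + suc (length vs)   ≡⟨ sym (length-++ us) ⟩
  length (us ++ x ∷ vs)         ∎
  where
  open ≤-Reasoning
  delete : xs ⊆ us ++ vs
  delete {y} y∈ with ∈-++⁻ us (sub (there y∈))
  ... | inj₁ p = ∈-++⁺ˡ p
  ... | inj₂ (here y≡x) = ⊥-elim (All.lookup x# y∈ (sym y≡x))
  ... | inj₂ (there p) = ∈-++⁺ʳ us p

module _ {N : ℕ} where

  open import Data.List.Membership.DecPropositional (Fin._≟_ {N}) using (_∈?_)

  infixl 6 _∖_
  _∖_ : List (Fin N) → List (Fin N) → List (Fin N)
  xs ∖ ys = filter (λ x → ¬? (x ∈? ys)) xs

  ∈-∖⁻ : ∀ {xs ys x} → x ∈ xs ∖ ys → x ∈ xs × x ∉ ys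
  ∈-∖⁻ {ys = ys} = ∈-filter⁻ (λ x → ¬? (x ∈? ys))

  ∈-∖⁺ : ∀ {xs ys x} → x ∈ xs → x ∉ ys → x ∈ xs ∖ ys
  ∈-∖⁺ {ys = ys} = ∈-filter⁺ (λ x → ¬? (x ∈? ys))

  ∖-unique : ∀ {xs} ys → Unique xs → Unique (xs ∖ ys)
  ∖-unique ys = Unique.filter⁺ (λ x → ¬? (x ∈? ys))

  length-∖ : ∀ {xs} ys → Unique xs → length xs ≤ length ys + length (xs ∖ ys)
  length-∖ {xs} ys xs! = begin
    length xs                       ≤⟨ unique⊆⇒length≤ xs! split ⟩
    length (ys ++ xs ∖ ys)          ≡⟨ length-++ ys ⟩
    length ys + length (xs ∖ ys)    ∎
    where
    open ≤-Reasoning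
    split : xs ⊆ ys ++ xs ∖ ys
    split {x} x∈ with x ∈? ys
    ... | yes p = ∈-++⁺ˡ p
    ... | no p = ∈-++⁺ʳ ys (∈-∖⁺ x∈ p)

  pick : ∀ {xs} ys → Unique xs → length ys < length xs → ∃ λ x → x ∈ xs × x ∉ ys
  pick {xs} ys xs! lt with xs ∖ ys in eq | length-∖ ys xs!
  ... | [] | le = ⊥-elim (<-irrefl refl (<-≤-trans lt (subst (length xs ≤_) (+-identityʳ _) le)))
  ... | x ∷ _ | _ = x , ∈-∖⁻ (subst (x ∈_) (sym eq) (here refl))

  module _ {R : Fin N → List (Fin N)} where

    -- Disjointness makes the concatenation of the lists `R x` repetition-free, so it fits into
    -- `ys`.
    disjoint-family : ∀ {xs ys r} → Unique xs → (∀ {x} → x ∈ xs → Unique (R x) × r ≤ length (R x) × R x ⊆ ys) →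
      (∀ {x x′ y} → x ∈ xs → x′ ∈ xs → y ∈ R x → y ∈ R x′ → x ≡ x′) →
      length xs * r ≤ length ys
    disjoint-family {xs} {ys} {r} xs! R! disj = ≤-trans (long xs λ p → proj₁ (proj₂ (R! p)))
        (unique⊆⇒length≤ (uniq xs! (λ p → proj₁ (R! p)) disj) (inside xs λ p → proj₂ (proj₂ (R! p))))
      where
      long : ∀ zs → (∀ {x} → x ∈ zs → r ≤ length (R x)) → length zs * r ≤ length (concatMap R zs)
      long [] _ = z≤n
      long (z ∷ zs) h = ≤-trans (+-mono-≤ (h (here refl)) (long zs (h ∘ there)))
        (≤-reflexive (sym (length-++ (R z))))
      member : ∀ zs {y} → y ∈ concatMap R zs → ∃ λ x → x ∈ zs × y ∈ R x
      member (z ∷ zs) p with ∈-++⁻ (R z) p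
      ... | inj₁ q = z , here refl , q
      ... | inj₂ q with member zs q
      ...   | x , x∈ , y∈ = x , there x∈ , y∈
      inside : ∀ zs → (∀ {x} → x ∈ zs → R x ⊆ ys) → concatMap R zs ⊆ ys
      inside zs h p with member zs p
      ... | x , x∈ , y∈ = h x∈ y∈
      uniq : ∀ {zs} → Unique zs → (∀ {x} → x ∈ zs → Unique (R x)) →
        (∀ {x x′ y} → x ∈ zs → x′ ∈ zs → y ∈ R x → y ∈ R x′ → x ≡ x′) → Unique (concatMap R zs)
      uniq [] _ _ = []
      uniq {z ∷ zs} (z# ∷ zs!) h d = Unique.++⁺ (h (here refl))
        (uniq zs! (h ∘ there) (λ p q → d (there p) (there q)))
        λ { (p , q) → let (x , x∈ , y∈) = member zs q in
              All.lookup z# x∈ (d (here refl) (there x∈) p y∈) }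

-- Neighbourhoods, complements and graphs given by edge lists.

Adj : ∀ {N} → Graph N → Fin N → Fin N → Set
Adj G x y = adj G x y ≡ true

Adj? : ∀ {N} (G : Graph N) x → Decidable (Adj G x)
Adj? G x y = adj G x y Bool.≟ true

Adj-sym : ∀ {N} (G : Graph N) {x y} → Adj G x y → Adj G y x
Adj-sym G {x} {y} e = trans (symm G y x) e

Adj⇒≢ : ∀ {N} (G : Graph N) {x y} → Adj G x y → x ≢ y
Adj⇒≢ G {x} e refl with () ← trans (sym (irrefl G x)) e

nbrs : ∀ {N} → Graph N → Fin N → List (Fin N)
nbrs G x = filter (Adj? G x) (allFin _)

degree : ∀ {N} → Graph N → Fin N → ℕ
degree G x = length (nbrs G x)

module _ {N : ℕ} (G : Graph N) where

  ∈-nbrs⁺ : ∀ {x y} → Adj G x y → y ∈ nbrs G x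
  ∈-nbrs⁺ {x} {y} = ∈-filter⁺ (Adj? G x) (∈-allFin y)

  ∈-nbrs⁻ : ∀ {x y} → y ∈ nbrs G x → Adj G x y
  ∈-nbrs⁻ {x} = proj₂ ∘ ∈-filter⁻ (Adj? G x) {xs = allFin N}

  nbrs-unique : ∀ x → Unique (nbrs G x)
  nbrs-unique x = Unique.filter⁺ (Adj? G x) (Unique.allFin⁺ N)

⌊⌋⁺ : ∀ {P : Set} {d : Dec P} → P → ⌊ d ⌋ ≡ true
⌊⌋⁺ {d = yes _} _ = refl
⌊⌋⁺ {d = no ¬p} p = ⊥-elim (¬p p)

⌊⌋⁻ : ∀ {P : Set} {d : Dec P} → ⌊ d ⌋ ≡ true → P
⌊⌋⁻ {d = yes p} _ = p

complement⁺ : ∀ {N} (G : Graph N) {x y} → x ≢ y → ¬ Adj G x y → Adj (complement G) x y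
complement⁺ G {x} {y} x≢y ¬e with x Fin.≟ y
... | yes p = ⊥-elim (x≢y p)
... | no _ with adj G x y
...   | true = ⊥-elim (¬e refl)
...   | false = refl

complement⁻ : ∀ {N} (G : Graph N) {x y} → Adj (complement G) x y → x ≢ y × ¬ Adj G x y
complement⁻ G {x} {y} e with x Fin.≟ y
... | no q with adj G x y
...   | false = q , λ ()

fromEdges⁺ : ∀ {n} e {x y : Fin n} → x ≢ y → e (toℕ x) (toℕ y) ≡ true → Adj (fromEdges n e) x y
fromEdges⁺ e {x} {y} x≢y p with x Fin.≟ y
... | yes q = ⊥-elim (x≢y q)
... | no _ rewrite p = refl

fromEdges⁻ : ∀ {n} e {x y : Fin n} → Adj (fromEdges n e) x y →
  x ≢ y × (e (toℕ x) (toℕ y) ≡ true ⊎ e (toℕ y) (toℕ x) ≡ true)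
fromEdges⁻ e {x} {y} p with x Fin.≟ y
... | no q with e (toℕ x) (toℕ y) | e (toℕ y) (toℕ x)
...   | true | _ = q , inj₁ refl
...   | false | true = q , inj₂ refl

-- Embedding the trees as stars with two hooked vertices.

-- Junk value: positions beyond the end of the list read as the default.
at : ∀ {A : Set} → A → List A → ℕ → A
at d [] _ = d
at d (x ∷ xs) zero = x
at d (x ∷ xs) (suc m) = at d xs m

at-∈ : ∀ {A : Set} {d : A} xs {m} → m < length xs → at d xs m ∈ xs
at-∈ (x ∷ xs) {zero} _ = here refl
at-∈ (x ∷ xs) {suc m} lt = there (at-∈ xs (s≤s⁻¹ lt))

at-++ : ∀ {A : Set} {d : A} xs {ys} m → at d (xs ++ ys) (m + length xs) ≡ at d ys m
at-++ {d = d} [] {ys} m = cong (at d ys) (+-identityʳ m)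
at-++ {d = d} (x ∷ xs) {ys} m = trans (cong (at d (x ∷ xs ++ ys)) (+-suc m (length xs))) (at-++ xs m)

at-injective : ∀ {A : Set} {d : A} {xs i j} → Unique xs → i < length xs → j < length xs →
  at d xs i ≡ at d xs j → i ≡ j
at-injective {xs = x ∷ xs} {zero} {zero} _ _ _ _ = refl
at-injective {xs = x ∷ xs} {zero} {suc j} (x# ∷ _) _ lt eq = ⊥-elim (All.lookup x# (at-∈ xs (s≤s⁻¹ lt)) eq)
at-injective {xs = x ∷ xs} {suc i} {zero} (x# ∷ _) lt _ eq = ⊥-elim (All.lookup x# (at-∈ xs (s≤s⁻¹ lt)) (sym eq))
at-injective {xs = x ∷ xs} {suc i} {suc j} (_ ∷ xs!) p q eq = cong suc (at-injective xs! (s≤s⁻¹ p) (s≤s⁻¹ q) eq)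

-- Here `p`, `q`, `w₁`, `w₂` are the images of the last four vertices in order. For `two`, `p` is an
-- ordinary leaf, kept so that both shapes share one interface.
Hooks : ∀ {N} → Graph N → Idx → (p q w₁ w₂ : Fin N) → Set
Hooks G one p q w₁ w₂ = Adj G p w₁ × Adj G q w₂
Hooks G two p q w₁ w₂ = Adj G q w₁ × Adj G q w₂

distinct₄ : ∀ {A : Set} {a b c d : A} → a ≢ b → a ≢ c → a ≢ d → b ≢ c → b ≢ d → c ≢ d →
  Unique (a ∷ b ∷ c ∷ d ∷ [])
distinct₄ ab ac ad bc bd cd = (ab ∷ ac ∷ ad ∷ []) ∷ (bc ∷ bd ∷ []) ∷ (cd ∷ []) ∷ [] ∷ []

∨⁻ : ∀ {b b′} → b ∨ b′ ≡ true → b ≡ true ⊎ b′ ≡ true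
∨⁻ {true} _ = inj₁ refl
∨⁻ {false} e = inj₂ e

module _ {N : ℕ} (G : Graph N) {c p q w₁ w₂ : Fin N} where

  -- The list enumerates the images of v₀, …, v_{n-1} in order, where n = 5 + length L.
  embed-list : ∀ i L → Unique (c ∷ L ++ p ∷ q ∷ w₁ ∷ w₂ ∷ []) → (∀ {x} → x ∈ L → Adj G c x) →
    Adj G c p → Adj G c q → Hooks G i p q w₁ w₂ → T (5 + length L) i ⊆ᵍ G
  embed-list i L xs! L-adj cp cq hooks = f , injective , preserves i hooks
    where
    k = length L
    ends = p ∷ q ∷ w₁ ∷ w₂ ∷ []
    g : ℕ → Fin N
    g = at c (c ∷ L ++ ends)
    f : Fin (5 + k) → Fin N
    f x = g (toℕ x)
    length-xs : length (c ∷ L ++ ends) ≡ 5 + k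
    length-xs = cong suc (trans (length-++ L) (+-comm k 4))
    injective : Injective _≡_ _≡_ f
    injective {x} {y} eq = toℕ-injective (at-injective xs! (bound x) (bound y) eq)
      where
      bound : ∀ z → toℕ z < length (c ∷ L ++ ends)
      bound z = subst (toℕ z <_) (sym length-xs) (toℕ<n z)
    leaf : ∀ M → (∀ {x} → x ∈ M → Adj G c x) → ∀ j → j ≤ suc (length M) → Adj G c (at c (M ++ ends) j)
    leaf [] h zero _ = cp
    leaf [] h (suc zero) _ = cq
    leaf [] h (suc (suc _)) (s≤s ())
    leaf (x ∷ M) h zero _ = h (here refl)
    leaf (x ∷ M) h (suc j) (s≤s le) = leaf M (h ∘ there) j le
    spoke : ∀ {u v} → ⌊ u ℕ.≟ 0 ⌋ ∧ ⌊ 1 ≤? v ⌋ ∧ ⌊ v ≤? 2 + k ⌋ ≡ true → Adj G (g u) (g v)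
    spoke {u} {zero} e with u ℕ.≟ 0
    spoke {u} {zero} () | yes _
    spoke {u} {zero} () | no _
    spoke {u} {suc v} e with u ℕ.≟ 0 | suc v ≤? 2 + k
    ... | yes refl | yes le = leaf L L-adj v (s≤s⁻¹ le)
    -- Since n = 5 + k, the entry `s` of `ends` is the image of the vertex with index n - 4 + s = 1
    -- + s + k.
    hook : ∀ {u v s t} → Adj G (at c ends s) (at c ends t) →
      ⌊ u ℕ.≟ suc (s + k) ⌋ ∧ ⌊ v ℕ.≟ suc (t + k) ⌋ ≡ true → Adj G (g u) (g v)
    hook {u} {v} {s} {t} st e with u ℕ.≟ suc (s + k) | v ℕ.≟ suc (t + k)
    ... | yes refl | yes refl = subst₂ (Adj G) (sym (at-++ L s)) (sym (at-++ L t)) st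
    edge₁ : Hooks G one p q w₁ w₂ → ∀ u v → isE₁ (5 + k) u v ≡ true → Adj G (g u) (g v)
    edge₁ (pw , qw) u v e with ∨⁻ e
    ... | inj₁ e₁ = spoke {u} {v} e₁
    ... | inj₂ e₁ with ∨⁻ e₁
    ...   | inj₁ e₂ = hook {u} {v} {0} {2} pw e₂
    ...   | inj₂ e₂ = hook {u} {v} {1} {3} qw e₂
    edge₂ : Hooks G two p q w₁ w₂ → ∀ u v → isE₂ (5 + k) u v ≡ true → Adj G (g u) (g v)
    edge₂ (qw₁ , qw₂) u v e with ∨⁻ e
    ... | inj₁ e₁ = spoke {u} {v} e₁
    ... | inj₂ e₁ with ∨⁻ e₁
    ...   | inj₁ e₂ = hook {u} {v} {1} {2} qw₁ e₂
    ...   | inj₂ e₂ = hook {u} {v} {1} {3} qw₂ e₂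
    symmetrised : ∀ e → (∀ u v → e u v ≡ true → Adj G (g u) (g v)) →
      ∀ x y → Adj (fromEdges (5 + k) e) x y → Adj G (f x) (f y)
    symmetrised e h x y xy with proj₂ (fromEdges⁻ e {x} {y} xy)
    ... | inj₁ p = h (toℕ x) (toℕ y) p
    ... | inj₂ p = Adj-sym G (h (toℕ y) (toℕ x) p)
    preserves : ∀ i → Hooks G i p q w₁ w₂ → ∀ x y → Adj (T (5 + k) i) x y → Adj G (f x) (f y)
    preserves one h = symmetrised _ (edge₁ h)
    preserves two h = symmetrised _ (edge₂ h)

  -- Surplus leaves are harmless: the first `k` of `L`, together with `p` and `q`, make up the k + 2
  -- leaves.
  plant : ∀ {k} i L → Unique L → k ≤ length L → (∀ {x} → x ∈ L → Adj G c x) →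
    (∀ {x} → x ∈ L → x ∉ p ∷ q ∷ w₁ ∷ w₂ ∷ []) → Adj G c p → Adj G c q → c ≢ w₁ → c ≢ w₂ →
    Unique (p ∷ q ∷ w₁ ∷ w₂ ∷ []) → Hooks G i p q w₁ w₂ → T (5 + k) i ⊆ᵍ G
  plant {k} i L L! le L-adj apart cp cq cw₁ cw₂ ends! hooks =
    subst (λ m → T (5 + m) i ⊆ᵍ G) (trans (length-take k L) (m≤n⇒m⊓n≡m le))
      (embed-list i (take k L) (All.tabulate fresh ∷ Unique.++⁺ (Unique.take⁺ k L!) ends! disj)
        (L-adj ∘ take⊆ k L) cp cq hooks)
    where
    take⊆ : ∀ m xs → take m xs ⊆ xs
    take⊆ (suc m) (x ∷ xs) (here e) = here e
    take⊆ (suc m) (x ∷ xs) (there e) = there (take⊆ m xs e)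
    disj : ∀ {x} → ¬ (x ∈ take k L × x ∈ p ∷ q ∷ w₁ ∷ w₂ ∷ [])
    disj (u , v) = apart (take⊆ k L u) v
    fresh : ∀ {x} → x ∈ take k L ++ p ∷ q ∷ w₁ ∷ w₂ ∷ [] → c ≢ x
    fresh x∈ with ∈-++⁻ (take k L) x∈
    ... | inj₁ u = Adj⇒≢ G (L-adj (take⊆ k L u))
    ... | inj₂ (here refl) = Adj⇒≢ G cp
    ... | inj₂ (there (here refl)) = Adj⇒≢ G cq
    ... | inj₂ (there (there (here refl))) = cw₁
    ... | inj₂ (there (there (there (here refl)))) = cw₂

-- The image of the centre has n - 3 = k + 2 neighbours; this is all that the lower bounds use about
-- the trees.
tree⇒degree : ∀ {k N} i (G : Graph N) → T (5 + k) i ⊆ᵍ G → ∃ λ x → 2 + k ≤ degree G x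
tree⇒degree {k} {N} i G (f , f-inj , f-adj) = f zero , (begin
  2 + k                         ≡⟨ sym (length-tabulate leaf) ⟩
  length (tabulate leaf)        ≤⟨ unique⊆⇒length≤ (Unique.tabulate⁺ leaf-inj) leaves⊆ ⟩
  degree G (f zero)             ∎)
  where
  open ≤-Reasoning
  index : Fin (2 + k) → Fin (5 + k)
  index y = suc (inject₁ (inject₁ y))
  leaf : Fin (2 + k) → Fin N
  leaf y = f (index y)
  leaf-inj : ∀ {x y} → leaf x ≡ leaf y → x ≡ y
  leaf-inj eq = inject₁-injective (inject₁-injective (suc-injective (f-inj eq)))
  spoke₁ : ∀ {m} → m ≤ suc k → isE₁ (5 + k) 0 (suc m) ≡ true
  spoke₁ {m} le rewrite ⌊⌋⁺ {d = suc m ≤? 2 + k} (s≤s le) = refl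
  spoke₂ : ∀ {m} → m ≤ suc k → isE₂ (5 + k) 0 (suc m) ≡ true
  spoke₂ {m} le rewrite ⌊⌋⁺ {d = suc m ≤? 2 + k} (s≤s le) = refl
  bound : ∀ y → toℕ (inject₁ (inject₁ y)) ≤ suc k
  bound y = subst (_≤ suc k) (sym (trans (toℕ-inject₁ (inject₁ y)) (toℕ-inject₁ y))) (s≤s⁻¹ (toℕ<n y))
  spoke : ∀ i y → Adj (T (5 + k) i) zero (index y)
  spoke one y = fromEdges⁺ (isE₁ (5 + k)) {zero} {index y} (λ ()) (spoke₁ (bound y))
  spoke two y = fromEdges⁺ (isE₂ (5 + k)) {zero} {index y} (λ ()) (spoke₂ (bound y))
  leaves⊆ : tabulate leaf ⊆ nbrs G (f zero)
  leaves⊆ x∈ with ∈-tabulate⁻ {f = leaf} x∈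
  ... | y , refl = ∈-nbrs⁺ G (f-adj zero (index y) (spoke i y))

-- Completing a star, or the sparsity that failure leaves.

-- What remains of the star at v when T i cannot be completed by hooking onto vertices satisfying P.
Sparse : ∀ {N} → Graph N → Fin N → (Fin N → Set) → Idx → Set
Sparse G v P one = ∃₂ λ a₀ w₀ → (w₀ ≡ v ⊎ P w₀) ×
  (∀ {a w} → Adj G v a → P w → Adj G a w → a ≢ a₀ → a ≢ w₀ → w ≡ a₀ ⊎ w ≡ w₀)
Sparse G v P two = ∀ {a w w′} → Adj G v a → P w → P w′ → Adj G a w → Adj G a w′ → w ≡ w′

module _ {N : ℕ} (G : Graph N) (v : Fin N) where

  -- For `one`, two disjoint edges from leaves to vertices of `P` complete the tree, so once an edge
  -- `a₀w₀` is fixed, every other such edge meets it. For `two`, a single leaf with two neighbours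
  -- in `P` suffices. `spare` guarantees `k` more leaves whatever four vertices are used.
  complete-or-sparse : ∀ {k} i {P : Fin N → Set} → Decidable P → (∀ {w} → P w → w ≢ v) → 4 ≤ degree G v →
    (∀ {p q w₁ w₂} → P w₁ → P w₂ → k ≤ length (nbrs G v ∖ (p ∷ q ∷ w₁ ∷ w₂ ∷ []))) →
    T (5 + k) i ⊆ᵍ G ⊎ Sparse G v P i
  complete-or-sparse {k} i {P} P? P⇒≢v 4≤D spare = go i
    where
    tree : ∀ i {p q w₁ w₂} → Adj G v p → Adj G v q → P w₁ → P w₂ →
      Unique (p ∷ q ∷ w₁ ∷ w₂ ∷ []) → Hooks G i p q w₁ w₂ → T (5 + k) i ⊆ᵍ G
    tree i {p} {q} {w₁} {w₂} vp vq Pw₁ Pw₂ ends! hooks =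
      plant G i (nbrs G v ∖ ends) (∖-unique ends (nbrs-unique G v)) (spare Pw₁ Pw₂)
        (∈-nbrs⁻ G ∘ proj₁ ∘ ∈-∖⁻) (proj₂ ∘ ∈-∖⁻ {xs = nbrs G v}) vp vq (P⇒≢v Pw₁ ∘ sym) (P⇒≢v Pw₂ ∘ sym) ends! hooks
      where ends = p ∷ q ∷ w₁ ∷ w₂ ∷ []
    go : ∀ i → T (5 + k) i ⊆ᵍ G ⊎ Sparse G v P i
    go one with any? (λ a → any? (λ w → Adj? G v a ×-dec P? w ×-dec Adj? G a w))
    -- No hooking edge exists: `v` serves as a dummy for both vertices, and sparsity is vacuous.
    ... | no none = inj₂ (v , v , inj₁ refl , λ va Pw aw _ _ → ⊥-elim (none (_ , _ , va , Pw , aw)))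
    ... | yes (a₀ , w₀ , va₀ , Pw₀ , a₀w₀)
      with any? (λ a → any? (λ w → (Adj? G v a ×-dec P? w ×-dec Adj? G a w) ×-dec
             (¬? (a Fin.≟ a₀) ×-dec ¬? (a Fin.≟ w₀)) ×-dec (¬? (w Fin.≟ a₀) ×-dec ¬? (w Fin.≟ w₀))))
    ...   | yes (a , w , (va , Pw , aw) , (aa₀ , aw₀) , (wa₀ , ww₀)) = inj₁ (tree one va₀ va Pw₀ Pw
              (distinct₄ (≢-sym aa₀) (Adj⇒≢ G a₀w₀) (≢-sym wa₀) aw₀ (Adj⇒≢ G aw) (≢-sym ww₀)) (a₀w₀ , aw))
    ...   | no none = inj₂ (a₀ , w₀ , inj₂ Pw₀ , star)
      where
      star : ∀ {a w} → Adj G v a → P w → Adj G a w → a ≢ a₀ → a ≢ w₀ → w ≡ a₀ ⊎ w ≡ w₀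
      star {a} {w} va Pw aw aa₀ aw₀ with w Fin.≟ a₀ | w Fin.≟ w₀
      ... | yes e | _ = inj₁ e
      ... | no _ | yes e = inj₂ e
      ... | no wa₀ | no ww₀ = ⊥-elim (none (a , w , (va , Pw , aw) , (aa₀ , aw₀) , (wa₀ , ww₀)))
    go two with any? (λ a → any? (λ w → any? (λ w′ → (Adj? G v a ×-dec P? w ×-dec P? w′) ×-dec
                  (Adj? G a w ×-dec Adj? G a w′ ×-dec ¬? (w Fin.≟ w′)))))
    ... | yes (a , w , w′ , (va , Pw , Pw′) , (aw , aw′ , ww′))
      -- The slot `p` can be filled by any fourth neighbour of `v`.
      with pick (a ∷ w ∷ w′ ∷ []) (nbrs-unique G v) 4≤D
    ...   | p , p∈ , p∉ = inj₁ (tree two (∈-nbrs⁻ G p∈) va Pw Pw′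
              (distinct₄ (p∉ ∘ here) (p∉ ∘ there ∘ here) (p∉ ∘ there ∘ there ∘ here)
                (Adj⇒≢ G aw) (Adj⇒≢ G aw′) ww′) (aw , aw′))
    go two | no none = inj₂ λ {a} {w} {w′} va Pw Pw′ aw aw′ → decidable-stable (w Fin.≟ w′)
               λ ww′ → none (a , w , w′ , (va , Pw , Pw′) , (aw , aw′ , ww′))

  -- Names the only possible neighbour of `a` in `P`; if there is none, `v` is returned as a
  -- default.
  partner : ∀ {P : Fin N → Set} → Decidable P → Sparse G v P two → ∀ {a} → Adj G v a →
    ∃ λ x → ∀ {w} → P w → Adj G a w → w ≡ x
  partner P? sparse {a} va with any? (λ w → P? w ×-dec Adj? G a w)
  ... | yes (x , Px , ax) = x , λ Pw aw → sparse va Pw Px aw ax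
  ... | no none = v , λ Pw aw → ⊥-elim (none (_ , Pw , aw))

-- Building the blue tree next to a sparse red star.

pick-any : ∀ {N} (ys : List (Fin N)) → length ys < N → ∃ λ x → x ∉ ys
pick-any {N} ys lt with pick ys (Unique.allFin⁺ N) (subst (length ys <_) (sym (length-tabulate {n = N} id)) lt)
... | x , _ , x∉ = x , x∉

9≤N : ∀ {k N} → 7 ≤ k → 3 + (k + k) ≤ N → 9 ≤ N
9≤N {k} 7≤k le = ≤-trans (+-monoʳ-≤ 3 (≤-trans (n≤1+n 6) (≤-trans 7≤k (m≤m+n k k)))) le

-- A path `p`, `w₁`, `q`, `w₂` contains the hooks of both shapes, so one construction serves both
-- values of the index.
hooks-any : ∀ {N} (G : Graph N) i {p q w₁ w₂} → Adj G p w₁ → Adj G q w₁ → Adj G q w₂ → Hooks G i p q w₁ w₂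
hooks-any G one pw₁ qw₁ qw₂ = pw₁ , qw₂
hooks-any G two pw₁ qw₁ qw₂ = qw₁ , qw₂

module _ {N : ℕ} (H : Graph N) where

  -- The centre is `a`, with `p` and `q` as the leaves that carry hooks. Outside `F` and these
  -- three, two vertices are hooked on, and at least N - 9 others remain as leaves; N - 9 is at
  -- least `k` because 9 + k is at most 3 + 2k.
  almost-universal⇒tree : ∀ {k} j F {a p q} → 7 ≤ k → 3 + (k + k) ≤ N → length F ≤ 4 → 4 + length F < N →
    (∀ {x y} → x ∈ a ∷ p ∷ q ∷ [] → y ∉ F → y ≢ x → Adj H x y) →
    Adj H a p → Adj H a q → p ≢ q → T (5 + k) j ⊆ᵍ H
  almost-universal⇒tree {k} j F {a} {p} {q} 7≤k N-large F-small 4+F<N universal ap aq p≢q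
    with pick-any (a ∷ p ∷ q ∷ F) (<-trans (n<1+n _) 4+F<N)
  ... | w₁ , w₁∉ with pick-any (w₁ ∷ a ∷ p ∷ q ∷ F) 4+F<N
  ...   | w₂ , w₂∉ = plant H j L (∖-unique used (Unique.allFin⁺ N)) L-long
            (λ x∈ → universal (here refl) (λ x∈F → L-avoids x∈ (there (there (there (there (there x∈F))))))
                      (λ e → L-avoids x∈ (there (there (here e)))))
            (λ x∈ → λ { (here e) → L-avoids x∈ (there (there (there (here e))))
                      ; (there (here e)) → L-avoids x∈ (there (there (there (there (here e)))))
                      ; (there (there (here e))) → L-avoids x∈ (here e)
                      ; (there (there (there (here e)))) → L-avoids x∈ (there (here e)) })
            ap aq (λ e → w₁∉ (here (sym e))) (λ e → w₂∉ (there (here (sym e))))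
            (distinct₄ p≢q (λ e → w₁∉ (there (here (sym e)))) (λ e → w₂∉ (there (there (here (sym e)))))
              (λ e → w₁∉ (there (there (here (sym e))))) (λ e → w₂∉ (there (there (there (here (sym e))))))
              (λ e → w₂∉ (here (sym e))))
            (hooks-any H j (universal (there (here refl)) (w₁∉ ∘ there ∘ there ∘ there) (w₁∉ ∘ there ∘ here))
              (universal (there (there (here refl))) (w₁∉ ∘ there ∘ there ∘ there) (w₁∉ ∘ there ∘ there ∘ here))
              (universal (there (there (here refl))) (w₂∉ ∘ there ∘ there ∘ there ∘ there)
                (w₂∉ ∘ there ∘ there ∘ there ∘ here)))
    where
    used = w₁ ∷ w₂ ∷ a ∷ p ∷ q ∷ F
    L = allFin N ∖ used
    L-avoids : ∀ {x} → x ∈ L → x ∉ used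
    L-avoids = proj₂ ∘ ∈-∖⁻ {xs = allFin N}
    L-long : k ≤ length L
    L-long = +-cancelˡ-≤ 9 k (length L) (begin
      9 + k                     ≤⟨ +-monoʳ-≤ 3 (+-monoˡ-≤ k (≤-trans (n≤1+n 6) 7≤k)) ⟩
      3 + (k + k)               ≤⟨ N-large ⟩
      N                         ≡⟨ sym (length-tabulate {n = N} id) ⟩
      length (allFin N)         ≤⟨ length-∖ used (Unique.allFin⁺ N) ⟩
      5 + length F + length L   ≤⟨ +-monoˡ-≤ (length L) (+-monoʳ-≤ 5 F-small) ⟩
      9 + length L              ∎)
      where open ≤-Reasoning

module _ {N : ℕ} (G H : Graph N) (cover : ∀ {x y} → x ≢ y → ¬ Adj G x y → Adj H x y) (v : Fin N) where

  private
    A = nbrs G v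
    A! = nbrs-unique G v

    -- The two ranges for hooked vertices: they may lie in `A` when `A` has leaves to spare (`Far`),
    -- and otherwise must lie outside it (`Rest`).
    Far Rest : Fin N → Set
    Far w = w ≢ v
    Rest w = w ≢ v × ¬ Adj G v w

    Far? : Decidable Far
    Far? w = ¬? (w Fin.≟ v)
    Rest? : Decidable Rest
    Rest? w = ¬? (w Fin.≟ v) ×-dec ¬? (Adj? G v w)

    B = allFin N ∖ (v ∷ A)
    B! : Unique B
    B! = ∖-unique (v ∷ A) (Unique.allFin⁺ N)
    B⁻ : ∀ {w} → w ∈ B → Rest w
    B⁻ w∈ = (λ e → ∉vA (here e)) , λ vw → ∉vA (there (∈-nbrs⁺ G vw))
      where ∉vA = proj₂ (∈-∖⁻ {xs = allFin N} w∈)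

  -- For `one`, a vertex of `A` other than `a₀` and `w₀` has red neighbours only among `v`, `a₀`,
  -- `w₀`. For `two`, each vertex of `A` has at most one red neighbour besides `v`. Three vertices
  -- of `A` are then blue to everything outside a set `F` of size at most 4.
  sparse⇒tree-far : ∀ {k} i j → 7 ≤ k → 3 + (k + k) ≤ N → 4 + k ≤ degree G v →
    Sparse G v Far i → T (5 + k) j ⊆ᵍ H
  sparse⇒tree-far {k} one j 7≤k N-large D-large (a₀ , w₀ , _ , star)
    with pick (a₀ ∷ w₀ ∷ []) A! (≤-trans (m≤n⇒m≤n+o k (n≤1+n 3)) D-large)
  ... | a , a∈ , a∉
    with pick (a ∷ a₀ ∷ w₀ ∷ []) A! (≤-trans (m≤m+n 4 k) D-large)
  ... | p , p∈ , p∉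
    with pick (p ∷ a ∷ a₀ ∷ w₀ ∷ []) A! (≤-trans (+-monoʳ-≤ 4 (≤-trans (s≤s z≤n) 7≤k)) D-large)
  ... | q , q∈ , q∉ =
    almost-universal⇒tree H j F 7≤k N-large (n≤1+n 3) (≤-trans (n≤1+n 8) (9≤N 7≤k N-large)) universal
      (universal (here refl) (outside p∈ (p∉ ∘ there)) (p∉ ∘ here))
      (universal (here refl) (outside q∈ (q∉ ∘ there ∘ there)) (q∉ ∘ there ∘ here))
      (λ e → q∉ (here (sym e)))
    where
    F = v ∷ a₀ ∷ w₀ ∷ []
    outside : ∀ {x} → x ∈ A → x ∉ a₀ ∷ w₀ ∷ [] → x ∉ F
    outside x∈ x∉ (here e) = Adj⇒≢ G (∈-nbrs⁻ G x∈) (sym e)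
    outside x∈ x∉ (there e) = x∉ e
    blue : ∀ {x y} → x ∈ A → x ∉ a₀ ∷ w₀ ∷ [] → y ∉ F → y ≢ x → Adj H x y
    blue x∈ x∉ y∉ y≢x = cover (≢-sym y≢x) λ xy →
      case star (∈-nbrs⁻ G x∈) (y∉ ∘ here) xy (x∉ ∘ here) (x∉ ∘ there ∘ here) of λ
        { (inj₁ e) → y∉ (there (here e)) ; (inj₂ e) → y∉ (there (there (here e))) }
    universal : ∀ {x y} → x ∈ a ∷ p ∷ q ∷ [] → y ∉ F → y ≢ x → Adj H x y
    universal (here refl) = blue a∈ a∉
    universal (there (here refl)) = blue p∈ (p∉ ∘ there)
    universal (there (there (here refl))) = blue q∈ (q∉ ∘ there ∘ there)
  sparse⇒tree-far {k} two j 7≤k N-large D-large sparse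
    with pick [] A! (≤-trans (s≤s z≤n) D-large)
  ... | a , a∈ , _ with partner G v Far? sparse (∈-nbrs⁻ G a∈)
  -- Avoiding `x`, the only possible red neighbour of `a` besides `v`, makes the edges from `a` to
  -- `p` and `q` blue.
  ... | x , ax with pick (a ∷ x ∷ []) A! (≤-trans (m≤n⇒m≤n+o k (n≤1+n 3)) D-large)
  ... | p , p∈ , p∉ with pick (p ∷ a ∷ x ∷ []) A! (≤-trans (m≤m+n 4 k) D-large)
  ... | q , q∈ , q∉
    with partner G v Far? sparse (∈-nbrs⁻ G p∈) | partner G v Far? sparse (∈-nbrs⁻ G q∈)
  ... | y , py | z , qz =
    almost-universal⇒tree H j F 7≤k N-large ≤-refl (9≤N 7≤k N-large) universal
      (cover (p∉ ∘ here ∘ sym) λ e → p∉ (there (here (ax (far p∈) e))))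
      (cover (q∉ ∘ there ∘ here ∘ sym) λ e → q∉ (there (there (here (ax (far q∈) e)))))
      (λ e → q∉ (here (sym e)))
    where
    F = v ∷ x ∷ y ∷ z ∷ []
    far : ∀ {u} → u ∈ A → Far u
    far u∈ = ≢-sym (Adj⇒≢ G (∈-nbrs⁻ G u∈))
    universal : ∀ {u w} → u ∈ a ∷ p ∷ q ∷ [] → w ∉ F → w ≢ u → Adj H u w
    universal (here refl) w∉ w≢ = cover (≢-sym w≢) λ e → w∉ (there (here (ax (w∉ ∘ here) e)))
    universal (there (here refl)) w∉ w≢ = cover (≢-sym w≢) λ e → w∉ (there (there (here (py (w∉ ∘ here) e))))
    universal (there (there (here refl))) w∉ w≢ =
      cover (≢-sym w≢) λ e → w∉ (there (there (there (here (qz (w∉ ∘ here) e)))))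

  -- The blue star is centred at `b`, with leaves in `L` and the extra leaf `v`. As `v` is blue to
  -- all of `B`, the path `a`, `b′`, `v`, `b″` is blue once `ab′` is, and it carries the hooks of
  -- either shape.
  star-outside⇒tree : ∀ {k} j {a b b′ b″} L → Unique L → suc k ≤ length L → L ⊆ A →
    (∀ {x} → x ∈ L → Adj H b x) → a ∈ L → Adj H a b′ → b ∈ B → b′ ∈ B → b″ ∈ B →
    b ≢ b′ → b ≢ b″ → b′ ≢ b″ → T (5 + k) j ⊆ᵍ H
  star-outside⇒tree {k} j {a} {b} {b′} {b″} L L! L-long L⊆A bL a∈ ab′ b∈ b′∈ b″∈ bb′ bb″ b′b″ =
    plant H j (L ∖ (a ∷ [])) (∖-unique (a ∷ []) L!)
      (s≤s⁻¹ (≤-trans L-long (length-∖ (a ∷ []) L!)))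
      (bL ∘ proj₁ ∘ ∈-∖⁻) apart (bL a∈) (cover (proj₁ (B⁻ b∈)) λ e → proj₂ (B⁻ b∈) (Adj-sym G e)) bb′ bb″
      (distinct₄ (λ e → Adj⇒≢ G (va a∈) (sym e)) (apartB (va a∈) b′∈) (apartB (va a∈) b″∈)
        (≢-sym (proj₁ (B⁻ b′∈))) (≢-sym (proj₁ (B⁻ b″∈))) b′b″)
      (hooks-any H j ab′ (vB b′∈) (vB b″∈))
    where
    va : ∀ {x} → x ∈ L → Adj G v x
    va x∈ = ∈-nbrs⁻ G (L⊆A x∈)
    vB : ∀ {x} → x ∈ B → Adj H v x
    vB x∈ = cover (≢-sym (proj₁ (B⁻ x∈))) (proj₂ (B⁻ x∈))
    apartB : ∀ {x y} → Adj G v x → y ∈ B → x ≢ y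
    apartB vx y∈ refl = proj₂ (B⁻ y∈) vx
    apart : ∀ {x} → x ∈ L ∖ (a ∷ []) → x ∉ a ∷ v ∷ b′ ∷ b″ ∷ []
    apart x∈ e with ∈-∖⁻ {xs = L} {ys = a ∷ []} x∈
    apart x∈ (here e) | _ , x∉ = x∉ (here e)
    apart x∈ (there (here e)) | x∈L , _ = Adj⇒≢ G (va x∈L) (sym e)
    apart x∈ (there (there (here e))) | x∈L , _ = apartB (va x∈L) b′∈ e
    apart x∈ (there (there (there (here e)))) | x∈L , _ = apartB (va x∈L) b″∈ e

  N≤1+D+B : N ≤ suc (degree G v + length B)
  N≤1+D+B = ≤-trans (≤-reflexive (sym (length-tabulate {n = N} id))) (length-∖ (v ∷ A) (Unique.allFin⁺ N))

  module _ {k : ℕ} (7≤k : 7 ≤ k) (N-large : 3 + (k + k) ≤ N) (2+k≤D : 2 + k ≤ degree G v) (D≤3+k : degree G v ≤ 3 + k) where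

    private
      k≤1+B : k ≤ suc (length B)
      k≤1+B = +-cancelˡ-≤ (3 + k) k (suc (length B)) (begin
        3 + (k + k)                        ≤⟨ N-large ⟩
        N                                  ≤⟨ N≤1+D+B ⟩
        suc (degree G v + length B)        ≤⟨ s≤s (+-monoˡ-≤ (length B) D≤3+k) ⟩
        suc (3 + k + length B)             ≡⟨ sym (+-suc (3 + k) (length B)) ⟩
        3 + k + suc (length B)             ∎)
        where open ≤-Reasoning

      6≤B : 6 ≤ length B
      6≤B = s≤s⁻¹ (≤-trans 7≤k k≤1+B)

    -- Otherwise every vertex of `B` has at least two red neighbours in `A`. Sparsity makes these
    -- sets disjoint, so 2|B| is at most |A|, hence at most k + 3 and at most |B| + 4, contradicting
    -- |B| ≥ 6.
    sparse⇒high-blue : Sparse G v Rest two → ∃ λ b → b ∈ B × suc k ≤ length (filter (Adj? H b) A)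
    sparse⇒high-blue sparse with any? (λ b → (b ∈? B) ×-dec (suc k ≤? length (filter (Adj? H b) A)))
      where open import Data.List.Membership.DecPropositional (Fin._≟_ {N}) using (_∈?_)
    ... | yes found = found
    ... | no none = ⊥-elim too-many
      where
      R : Fin N → List (Fin N)
      R b = filter (Adj? G b) A
      R-long : ∀ {b} → b ∈ B → degree G v ≤ length (R b) + k
      R-long {b} b∈ = begin
        length A                                               ≤⟨ unique⊆⇒length≤ A! split ⟩
        length (R b ++ filter (Adj? H b) A)                    ≡⟨ length-++ (R b) ⟩
        length (R b) + length (filter (Adj? H b) A)            ≤⟨ +-monoʳ-≤ (length (R b)) (s≤s⁻¹ (≰⇒> λ h → none (b , b∈ , h))) ⟩
        length (R b) + k                                       ∎
        where
        open ≤-Reasoning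
        split : A ⊆ R b ++ filter (Adj? H b) A
        split {x} x∈ with Adj? G b x
        ... | yes e = ∈-++⁺ˡ (∈-filter⁺ (Adj? G b) x∈ e)
        ... | no e = ∈-++⁺ʳ (R b) (∈-filter⁺ (Adj? H b) x∈
                       (cover (λ { refl → proj₂ (B⁻ b∈) (∈-nbrs⁻ G x∈) }) e))
      count : length B * 2 ≤ degree G v
      count = disjoint-family {R = R} {ys = A} B!
        (λ {b} b∈ → Unique.filter⁺ (Adj? G b) A! , +-cancelʳ-≤ k 2 _ (≤-trans 2+k≤D (R-long b∈)) ,
                    proj₁ ∘ ∈-filter⁻ (Adj? G b))
        λ {b} {b′} b∈ b′∈ y∈ y∈′ → let (y∈A , by) = ∈-filter⁻ (Adj? G b) y∈
                                       (_ , b′y) = ∈-filter⁻ (Adj? G b′) {xs = A} y∈′ in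
          sparse (∈-nbrs⁻ G y∈A) (B⁻ b∈) (B⁻ b′∈) (Adj-sym G by) (Adj-sym G b′y)
      too-many : ⊥
      too-many = <⇒≱ (+-monoˡ-< (length B) (≤-trans (n≤1+n 5) 6≤B)) (begin
        length B + length B      ≡⟨ cong (length B +_) (sym (+-identityʳ (length B))) ⟩
        2 * length B             ≡⟨ *-comm 2 (length B) ⟩
        length B * 2             ≤⟨ count ⟩
        degree G v               ≤⟨ D≤3+k ⟩
        3 + k                    ≤⟨ +-monoʳ-≤ 3 k≤1+B ⟩
        4 + length B             ∎)
        where open ≤-Reasoning

    -- For `one`, the pairs between `A` without `a₀` and `B` without `a₀`, `w₀` are all blue; for
    -- `two`, the centre comes from `sparse⇒high-blue`. The vertex `b″` need only be distinct from
    -- `b` and `b′`, since it is hooked onto `v`.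
    sparse⇒tree-near : ∀ i j → Sparse G v Rest i → T (5 + k) j ⊆ᵍ H
    sparse⇒tree-near one j (a₀ , w₀ , w₀-out , star)
      with pick (a₀ ∷ w₀ ∷ []) B! (≤-trans (m≤m+n 3 3) 6≤B)
    ... | b , b∈ , b∉ with pick (b ∷ a₀ ∷ w₀ ∷ []) B! (≤-trans (m≤m+n 4 2) 6≤B)
    ... | b′ , b′∈ , b′∉ with pick (b ∷ b′ ∷ []) B! (≤-trans (m≤m+n 3 3) 6≤B)
    ... | b″ , b″∈ , b″∉ with pick (a₀ ∷ []) A! (≤-trans (m≤m+n 2 k) 2+k≤D)
    ... | a , a∈ , a∉ =
      star-outside⇒tree j (A ∖ (a₀ ∷ [])) (∖-unique (a₀ ∷ []) A!)
        (s≤s⁻¹ (≤-trans 2+k≤D (length-∖ (a₀ ∷ []) A!))) (proj₁ ∘ ∈-∖⁻)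
        (λ x∈ → Adj-sym H (blue x∈ b∈ b∉)) a∈L (blue a∈L b′∈ (b′∉ ∘ there)) b∈ b′∈ b″∈
        (λ e → b′∉ (here (sym e))) (λ e → b″∉ (here (sym e))) (λ e → b″∉ (there (here (sym e))))
      where
      a∈L = ∈-∖⁺ a∈ a∉
      -- As `w₀` is not in `A`, only `a₀` has to be dropped there, which leaves the required k + 1
      -- vertices even when |A| = k + 2.
      off-w₀ : ∀ {x} → w₀ ≡ v ⊎ Rest w₀ → x ∈ A → x ≢ w₀
      off-w₀ (inj₁ refl) x∈ e = Adj⇒≢ G (∈-nbrs⁻ G x∈) (sym e)
      off-w₀ (inj₂ (_ , out)) x∈ refl = out (∈-nbrs⁻ G x∈)
      blue : ∀ {x y} → x ∈ A ∖ (a₀ ∷ []) → y ∈ B → y ∉ a₀ ∷ w₀ ∷ [] → Adj H x y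
      blue x∈ y∈ y∉ with ∈-∖⁻ x∈
      ... | x∈A , x∉ = cover (λ { refl → proj₂ (B⁻ y∈) (∈-nbrs⁻ G x∈A) }) λ xy →
        case star (∈-nbrs⁻ G x∈A) (B⁻ y∈) xy (x∉ ∘ here) (off-w₀ w₀-out x∈A) of λ
          { (inj₁ e) → y∉ (here e) ; (inj₂ e) → y∉ (there (here e)) }
    sparse⇒tree-near two j sparse with sparse⇒high-blue sparse
    ... | b , b∈ , L-long
      with pick [] (Unique.filter⁺ (Adj? H b) A!) (≤-trans (s≤s z≤n) L-long)
    ... | a , a∈ , _ with partner G v Rest? sparse (∈-nbrs⁻ G (proj₁ (∈-filter⁻ (Adj? H b) a∈)))
    -- Choosing `b′` different from `x` makes `ab′` blue.
    ... | x , ax with pick (b ∷ x ∷ []) B! (≤-trans (m≤m+n 3 3) 6≤B)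
    ... | b′ , b′∈ , b′∉ with pick (b ∷ b′ ∷ []) B! (≤-trans (m≤m+n 3 3) 6≤B)
    ... | b″ , b″∈ , b″∉ =
      star-outside⇒tree j (filter (Adj? H b) A) (Unique.filter⁺ (Adj? H b) A!) L-long
        (proj₁ ∘ ∈-filter⁻ (Adj? H b)) (proj₂ ∘ ∈-filter⁻ (Adj? H b) {xs = A}) a∈
        (cover (λ { refl → proj₂ (B⁻ b′∈) (∈-nbrs⁻ G (proj₁ (∈-filter⁻ (Adj? H b) a∈))) })
          λ e → b′∉ (there (here (ax (B⁻ b′∈) e))))
        b∈ b′∈ b″∈ (λ e → b′∉ (here (sym e))) (λ e → b″∉ (here (sym e))) (λ e → b″∉ (there (here (sym e))))

  -- With k + 4 neighbours, `k` leaves survive the removal of all four special vertices. With k + 2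
  -- or k + 3, the hooked vertices are kept outside `A`, so that only `p` and `q` are lost.
  high-degree⇒tree : ∀ {k} i j → 7 ≤ k → 3 + (k + k) ≤ N → 2 + k ≤ degree G v →
    T (5 + k) i ⊆ᵍ G ⊎ T (5 + k) j ⊆ᵍ H
  high-degree⇒tree {k} i j 7≤k N-large 2+k≤D with 4 + k ≤? degree G v
  ... | yes 4+k≤D = map₂ (sparse⇒tree-far i j 7≤k N-large 4+k≤D)
    (complete-or-sparse G v i Far? id (≤-trans (m≤m+n 4 k) 4+k≤D)
      λ {p} {q} {w₁} {w₂} _ _ → +-cancelˡ-≤ 4 k _ (≤-trans 4+k≤D (length-∖ (p ∷ q ∷ w₁ ∷ w₂ ∷ []) A!)))
  ... | no 4+k≰D = map₂ (sparse⇒tree-near 7≤k N-large 2+k≤D (s≤s⁻¹ (≰⇒> 4+k≰D)) i j)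
    (complete-or-sparse G v i Rest? proj₁ (≤-trans (+-monoʳ-≤ 2 (≤-trans (m≤m+n 2 5) 7≤k)) 2+k≤D) spare)
    where
    spare : ∀ {p q w₁ w₂} → Rest w₁ → Rest w₂ → k ≤ length (A ∖ (p ∷ q ∷ w₁ ∷ w₂ ∷ []))
    spare {p} {q} {w₁} {w₂} (_ , out₁) (_ , out₂) =
      ≤-trans (+-cancelˡ-≤ 2 k _ (≤-trans 2+k≤D (length-∖ (p ∷ q ∷ []) A!)))
        (unique⊆⇒length≤ (∖-unique (p ∷ q ∷ []) A!) inside)
      where
      inside : A ∖ (p ∷ q ∷ []) ⊆ A ∖ (p ∷ q ∷ w₁ ∷ w₂ ∷ [])
      inside {x} x∈ with ∈-∖⁻ {xs = A} {ys = p ∷ q ∷ []} x∈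
      ... | x∈A , x∉ = ∈-∖⁺ {ys = p ∷ q ∷ w₁ ∷ w₂ ∷ []} x∈A λ
        { (here e) → x∉ (here e) ; (there (here e)) → x∉ (there (here e))
        ; (there (there (here refl))) → out₁ (∈-nbrs⁻ G x∈A)
        ; (there (there (there (here refl)))) → out₂ (∈-nbrs⁻ G x∈A) }

-- Parity of degree sums.

indicator : Bool → ℕ
indicator true = 1
indicator false = 0

length-filter-tabulate : ∀ {n} {A : Set} (f : A → Bool) (g : Fin n → A) →
  length (filter (λ y → f y Bool.≟ true) (tabulate g)) ≡ sum (λ i → indicator (f (g i)))
length-filter-tabulate {zero} f g = refl
length-filter-tabulate {suc n} f g with f (g zero)
... | true = cong suc (length-filter-tabulate f (g ∘ suc))
... | false = length-filter-tabulate f (g ∘ suc)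

-- The handshake lemma for matrices, by induction: the first row and the first column agree and meet
-- in a zero, so removing them subtracts twice `row`.
sum-symmetric-even : ∀ {n} (a : Fin n → Fin n → ℕ) → (∀ x y → a x y ≡ a y x) → (∀ x → a x x ≡ 0) →
  2 ∣ sum (λ x → sum (a x))
sum-symmetric-even {zero} a a-sym a-diag = divides 0 refl
sum-symmetric-even {suc n} a a-sym a-diag = subst (2 ∣_) (sym split)
  (∣m∣n⇒∣m+n (m∣m*n row) (sum-symmetric-even inner (λ x y → a-sym (suc x) (suc y)) (a-diag ∘ suc)))
  where
  inner = λ x y → a (suc x) (suc y)
  row = sum (λ y → a zero (suc y))
  rest = sum (λ x → sum (inner x))
  open ≡-Reasoning
  split : sum (λ x → sum (a x)) ≡ 2 * row + rest
  split = begin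
    a zero zero + row + sum (λ x → a (suc x) zero + sum (inner x))
      ≡⟨ cong₂ _+_ (cong (_+ row) (a-diag zero)) (∑-distrib-+ (λ x → a (suc x) zero) (λ x → sum (inner x))) ⟩
    row + (sum (λ x → a (suc x) zero) + rest)
      ≡⟨ cong (λ s → row + (s + rest)) (sum-cong-≗ (λ x → a-sym (suc x) zero)) ⟩
    row + (row + rest)
      ≡⟨ sym (+-assoc row row rest) ⟩
    row + row + rest
      ≡⟨ cong (λ s → row + s + rest) (sym (+-identityʳ row)) ⟩
    2 * row + rest ∎

sum-const : ∀ {n} (f : Fin n → ℕ) {m} → (∀ x → f x ≡ m) → sum f ≡ n * m
sum-const {zero} f h = refl
sum-const {suc n} f h = cong₂ _+_ (h zero) (sum-const (f ∘ suc) (h ∘ suc))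

regular⇒even : ∀ {N m} (G : Graph N) → (∀ x → degree G x ≡ m) → 2 ∣ N * m
regular⇒even G regular = subst (2 ∣_)
  (sum-const _ λ x → trans (sym (length-filter-tabulate (adj G x) id)) (regular x))
  (sum-symmetric-even (λ x y → indicator (adj G x y)) (λ x y → cong indicator (symm G x y))
    (λ x → cong indicator (irrefl G x)))

-- Upper bounds for the Ramsey numbers.

module _ {N : ℕ} (G : Graph N) where

  degree-sum : ∀ x → N ≤ suc (degree G x + degree (complement G) x)
  degree-sum x = begin
    N                                                          ≡⟨ sym (length-tabulate {n = N} id) ⟩
    length (allFin N)                                          ≤⟨ unique⊆⇒length≤ (Unique.allFin⁺ N) all ⟩
    suc (length (nbrs G x ++ nbrs (complement G) x))           ≡⟨ cong suc (length-++ (nbrs G x)) ⟩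
    suc (degree G x + degree (complement G) x)                 ∎
    where
    open ≤-Reasoning
    all : allFin N ⊆ x ∷ nbrs G x ++ nbrs (complement G) x
    all {y} _ with x Fin.≟ y | Adj? G x y
    ... | yes refl | _ = here refl
    ... | no _ | yes e = there (∈-++⁺ˡ (∈-nbrs⁺ G e))
    ... | no x≢y | no ¬e = there (∈-++⁺ʳ (nbrs G x) (∈-nbrs⁺ (complement G) {x} (complement⁺ G x≢y ¬e)))

  module _ {k : ℕ} (i j : Idx) (7≤k : 7 ≤ k) (N-large : 3 + (k + k) ≤ N) where

    red-star⇒tree : ∀ x → 2 + k ≤ degree G x → (T (5 + k) i ⊆ᵍ G) ⊎ (T (5 + k) j ⊆ᵍ complement G)
    red-star⇒tree x = high-degree⇒tree G (complement G) (complement⁺ G) x i j 7≤k N-large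

    -- The star argument asks only that pairs non-adjacent in one graph be adjacent in the other, so
    -- it applies with the colours and the indices exchanged.
    blue-star⇒tree : ∀ x → 2 + k ≤ degree (complement G) x → (T (5 + k) i ⊆ᵍ G) ⊎ (T (5 + k) j ⊆ᵍ complement G)
    blue-star⇒tree x le = Sum.swap (high-degree⇒tree (complement G) G
      (λ {u} {w} u≢w ¬e → decidable-stable (Adj? G u w) (¬e ∘ complement⁺ G u≢w)) x j i 7≤k N-large le)

2∣m+m : ∀ m → 2 ∣ m + m
2∣m+m m = divides m (trans (cong (m +_) (sym (+-identityʳ m))) (*-comm 2 m))

-- The two degrees of any vertex add up to at least 2k + 3, so one of them is at least k + 2.
ramsey-even : ∀ {k} i j → 7 ≤ k → RamseyHolds (T (5 + k) i) (T (5 + k) j) (4 + (k + k))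
ramsey-even {k} i j 7≤k G with 2 + k ≤? degree G zero
... | yes le = red-star⇒tree G i j 7≤k (n≤1+n _) zero le
... | no ≰ = blue-star⇒tree G i j 7≤k (n≤1+n _) zero (+-cancelˡ-≤ (2 + k) (2 + k) _ (begin
  2 + k + (2 + k)                                              ≡⟨ cong (2 +_) (trans (+-suc k (suc k)) (cong suc (+-suc k k))) ⟩
  4 + (k + k)                                                  ≤⟨ degree-sum G zero ⟩
  suc (degree G zero + degree (complement G) zero)             ≤⟨ +-monoˡ-≤ (degree (complement G) zero) (≰⇒> ≰) ⟩
  2 + k + degree (complement G) zero                           ∎))
  where open ≤-Reasoning

-- Without a star of either colour, `G` is (k + 1)-regular on 2k + 3 vertices. For odd n both
-- numbers are odd, against the evenness of the degree sum.
ramsey-odd : ∀ {k} i j → 7 ≤ k → ¬ (2 ∣ 5 + k) → RamseyHolds (T (5 + k) i) (T (5 + k) j) (3 + (k + k))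
ramsey-odd {k} i j 7≤k odd G with any? (λ x → 2 + k ≤? degree G x) | any? (λ x → 2 + k ≤? degree (complement G) x)
... | yes (x , le) | _ = red-star⇒tree G i j 7≤k ≤-refl x le
... | no _ | yes (x , le) = blue-star⇒tree G i j 7≤k ≤-refl x le
... | no ≰red | no ≰blue with euclidsLemma (3 + (k + k)) (1 + k) prime[2] (regular⇒even G regular)
  where
  regular : ∀ x → degree G x ≡ 1 + k
  regular x = ≤-antisym (s≤s⁻¹ (≰⇒> λ le → ≰red (x , le))) (+-cancelʳ-≤ (2 + k) (1 + k) _ (begin
    1 + k + (2 + k)                                   ≡⟨ cong suc (trans (+-suc k (suc k)) (cong suc (+-suc k k))) ⟩
    3 + (k + k)                                       ≤⟨ degree-sum G x ⟩
    suc (degree G x + degree (complement G) x)        ≡⟨ sym (+-suc (degree G x) _) ⟩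
    degree G x + suc (degree (complement G) x)        ≤⟨ +-monoʳ-≤ (degree G x) (≰⇒> λ le → ≰blue (x , le)) ⟩
    degree G x + (2 + k)                              ∎))
    where open ≤-Reasoning
... | inj₁ 2∣N = ⊥-elim (from-no (2 ∣? 3) (∣m+n∣m⇒∣n (subst (2 ∣_) (+-comm 3 (k + k)) 2∣N) (2∣m+m k)))
... | inj₂ 2∣1+k = ⊥-elim (odd (∣m∣n⇒∣m+n {2} {4} (divides 2 refl) 2∣1+k))

-- Lower bounds from blow-ups with small degrees in both colours.

small-degrees⇒¬ramsey : ∀ {k N} i j (G : Graph N) → (∀ x → degree G x ≤ 1 + k) →
  (∀ x → degree (complement G) x ≤ 1 + k) → ¬ RamseyHolds (T (5 + k) i) (T (5 + k) j) N
small-degrees⇒¬ramsey i j G red blue holds with holds G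
... | inj₁ t = let (x , le) = tree⇒degree i G t in <⇒≱ (s≤s (red x)) le
... | inj₂ t = let (x , le) = tree⇒degree j (complement G) t in <⇒≱ (s≤s (blue x)) le

-- A blow-up: vertices fall into consecutive intervals, the blocks; the tables red and blue
-- list the blocks whose vertices are joined to a given block in the graph and in its complement.
record Blocks (m N : ℕ) : Set where
  field
    block : ℕ → Fin m
    start size : Fin m → ℕ
    red blue : Fin m → List (Fin m)
    red-sym : ∀ c d → d ∈ red c → c ∈ red d
    red∪blue : ∀ c d → d ∈ red c ⊎ d ∈ blue c
  members : Fin m → List ℕ
  members c = applyUpTo (start c +_) (size c)
  weight : List (Fin m) → ℕ
  weight cs = sumˡ (map size cs)
  -- A vertex lying in one of its own neighbouring blocks is not its own neighbour.
  Light : ℕ → Fin m → List (Fin m) → Set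
  Light b c cs = weight cs ≤ b ⊎ (c ∈ cs × weight cs ≤ suc b)
  field
    located : ∀ {x} → x < N → x ∈ members (block x)

module _ {m N : ℕ} (𝔹 : Blocks m N) where
  open Blocks 𝔹
  open import Data.List.Membership.DecPropositional (Fin._≟_ {m}) using (_∈?_)

  -- The number of vertices is independent of `N`: truncating a pattern does not raise degrees, so
  -- one pattern refutes every `N′` up to `N`.
  blow-up : ∀ N′ → Graph N′
  blow-up N′ = fromEdges N′ (λ u w → ⌊ block w ∈? red (block u) ⌋)

  private
    length-members : ∀ cs → length (concatMap members cs) ≡ weight cs
    length-members [] = refl
    length-members (c ∷ cs) = trans (length-++ (members c))
      (cong₂ _+_ (length-applyUpTo (start c +_) (size c)) (length-members cs))

    ∈-members : ∀ {x c} cs → c ∈ cs → x ∈ members c → x ∈ concatMap members cs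
    ∈-members (c ∷ cs) (here refl) x∈ = ∈-++⁺ˡ x∈
    ∈-members (c ∷ cs) (there c∈) x∈ = ∈-++⁺ʳ (members c) (∈-members cs c∈ x∈)

  light⇒degree≤ : ∀ {N′ b} (K : Graph N′) x cs → N′ ≤ N → Light b (block (toℕ x)) cs →
    (∀ y → Adj K x y → block (toℕ y) ∈ cs) → degree K x ≤ b
  light⇒degree≤ {N′} {b} K x cs N′≤N light near = case light of λ
    { (inj₁ le) → ≤-trans (fits (nbrs-unique K x) (near _ ∘ ∈-nbrs⁻ K)) le
    -- The vertex `x` is counted along with its neighbours, since it occupies a place in the listed
    -- blocks; this gains the one unit.
    ; (inj₂ (c∈ , le)) → s≤s⁻¹ (≤-trans (fits (All.tabulate (Adj⇒≢ K ∘ ∈-nbrs⁻ K) ∷ nbrs-unique K x)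
        λ { (here refl) → c∈ ; (there y∈) → near _ (∈-nbrs⁻ K y∈) }) le) }
    where
    open ≤-Reasoning
    fits : ∀ {ys} → Unique ys → (∀ {y} → y ∈ ys → block (toℕ y) ∈ cs) → length ys ≤ weight cs
    fits {ys} ys! h = begin
      length ys                           ≡⟨ sym (length-map toℕ ys) ⟩
      length (map toℕ ys)                 ≤⟨ unique⊆⇒length≤ (Unique.map⁺ toℕ-injective ys!) inside ⟩
      length (concatMap members cs)       ≡⟨ length-members cs ⟩
      weight cs                           ∎
      where
      inside : map toℕ ys ⊆ concatMap members cs
      inside z∈ with ∈-map⁻ toℕ z∈
      ... | y , y∈ , refl = ∈-members cs (h y∈) (located (<-≤-trans (toℕ<n y) N′≤N))

  blow-up⇒¬ramsey : ∀ {k N′} i j → N′ ≤ N → (∀ c → Light (1 + k) c (red c)) → (∀ c → Light (1 + k) c (blue c)) →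
    ¬ RamseyHolds (T (5 + k) i) (T (5 + k) j) N′
  blow-up⇒¬ramsey {k} {N′} i j N′≤N red-light blue-light = small-degrees⇒¬ramsey i j K
    (λ x → light⇒degree≤ K x (red (block (toℕ x))) N′≤N (red-light _) (near-red x))
    (λ x → light⇒degree≤ (complement K) x (blue (block (toℕ x))) N′≤N (blue-light _) (near-blue x))
    where
    K = blow-up N′
    near-red : ∀ x y → Adj K x y → block (toℕ y) ∈ red (block (toℕ x))
    near-red x y xy with proj₂ (fromEdges⁻ _ {x} {y} xy)
    ... | inj₁ e = ⌊⌋⁻ e
    ... | inj₂ e = red-sym _ _ (⌊⌋⁻ e)
    near-blue : ∀ x y → Adj (complement K) x y → block (toℕ y) ∈ blue (block (toℕ x))
    near-blue x y xy with complement⁻ K {x} {y} xy | red∪blue (block (toℕ x)) (block (toℕ y))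
    ... | _ | inj₂ d∈ = d∈
    ... | x≢y , ¬e | inj₁ d∈ = ⊥-elim (¬e (fromEdges⁺ _ {x} {y} x≢y (⌊⌋⁺ d∈)))

∈-interval : ∀ {s l x} → s ≤ x → x < s + l → x ∈ applyUpTo (s +_) l
∈-interval {s} {l} {x} s≤x x<s+l = subst (_∈ applyUpTo (s +_) l) (m+[n∸m]≡n s≤x)
  (∈-applyUpTo⁺ (s +_) (+-cancelˡ-< s (x ∸ s) l (subst (_< s + l) (sym (m+[n∸m]≡n s≤x)) x<s+l)))

-- Red is two disjoint complete graphs on `a` vertices and blue is complete bipartite; for a = k + 1
-- the blue degree is the largest permitted.
two-cliques : ∀ a → Blocks 2 (a + a)
two-cliques a = record
  { block = block ; start = start ; size = λ _ → a ; red = red ; blue = blue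
  ; red-sym = from-yes (all? λ c → all? λ d → (d ∈? red c) →-dec (c ∈? red d))
  ; red∪blue = from-yes (all? λ c → all? λ d → (d ∈? red c) ⊎-dec (d ∈? blue c))
  ; located = located
  }
  where
  open import Data.List.Membership.DecPropositional (Fin._≟_ {2}) using (_∈?_)
  block : ℕ → Fin 2
  block x with x <? a
  ... | yes _ = # 0
  ... | no _ = # 1
  start : Fin 2 → ℕ
  start zero = 0
  start (suc _) = a
  red blue : Fin 2 → List (Fin 2)
  red c = c ∷ []
  blue zero = # 1 ∷ []
  blue (suc zero) = # 0 ∷ []
  located : ∀ {x} → x < a + a → x ∈ applyUpTo (start (block x) +_) a
  located {x} lt with x <? a
  ... | yes x<a = ∈-interval z≤n x<a
  ... | no x≮a = ∈-interval (≮⇒≥ x≮a) lt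

-- A self-complementary pattern: the path 0 – 1 – 2 – 3 of blocks of size e, whose end blocks are
-- cliques and are joined to the single vertex of block 4. Both colours are 2e-regular.
five-blocks : ∀ e → Blocks 5 (suc (e + e + e + e))
five-blocks e = record
  { block = block ; start = start ; size = size ; red = red ; blue = blue
  ; red-sym = from-yes (all? λ c → all? λ d → (d ∈? red c) →-dec (c ∈? red d))
  ; red∪blue = from-yes (all? λ c → all? λ d → (d ∈? red c) ⊎-dec (d ∈? blue c))
  ; located = located
  }
  where
  open import Data.List.Membership.DecPropositional (Fin._≟_ {5}) using (_∈?_)
  block : ℕ → Fin 5
  block x with x <? e
  ... | yes _ = # 0
  ... | no _ with x <? e + e
  ...   | yes _ = # 1
  ...   | no _ with x <? e + e + e
  ...     | yes _ = # 2
  ...     | no _ with x <? e + e + e + e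
  ...       | yes _ = # 3
  ...       | no _ = # 4
  start size : Fin 5 → ℕ
  start 0F = 0
  start 1F = e
  start 2F = e + e
  start 3F = e + e + e
  start 4F = e + e + e + e
  size 4F = 1
  size _ = e
  red blue : Fin 5 → List (Fin 5)
  red 0F = 0F ∷ 1F ∷ 4F ∷ []
  red 1F = 0F ∷ 2F ∷ []
  red 2F = 1F ∷ 3F ∷ []
  red 3F = 2F ∷ 3F ∷ 4F ∷ []
  red 4F = 0F ∷ 3F ∷ []
  blue 0F = 2F ∷ 3F ∷ []
  blue 1F = 1F ∷ 3F ∷ 4F ∷ []
  blue 2F = 0F ∷ 2F ∷ 4F ∷ []
  blue 3F = 0F ∷ 1F ∷ []
  blue 4F = 1F ∷ 2F ∷ 4F ∷ []
  located : ∀ {x} → x < suc (e + e + e + e) → x ∈ applyUpTo (start (block x) +_) (size (block x))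
  located {x} lt with x <? e
  ... | yes p = ∈-interval z≤n p
  ... | no q₀ with x <? e + e
  ...   | yes p = ∈-interval (≮⇒≥ q₀) p
  ...   | no q₁ with x <? e + e + e
  ...     | yes p = ∈-interval (≮⇒≥ q₁) p
  ...     | no q₂ with x <? e + e + e + e
  ...       | yes p = ∈-interval (≮⇒≥ q₂) p
  ...       | no q₃ = ∈-interval (≮⇒≥ q₃) (subst (x <_) (+-comm 1 _) lt)

¬ramsey-odd : ∀ {k N} i j → N ≤ (1 + k) + (1 + k) → ¬ RamseyHolds (T (5 + k) i) (T (5 + k) j) N
¬ramsey-odd {k} i j N≤ = blow-up⇒¬ramsey (two-cliques (1 + k)) i j N≤
  (λ _ → inj₁ one-block) λ { 0F → inj₁ one-block ; 1F → inj₁ one-block }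
  where
  one-block : 1 + k + 0 ≤ 1 + k
  one-block = ≤-reflexive (+-identityʳ (1 + k))

-- With k + 1 = 2e, the five-block pattern has 4e + 1 = 2k + 3 vertices. A block not listed in its
-- own row sees weight at most 2e; one that is listed sees 2e + 1, itself included.
¬ramsey-even : ∀ {k e N} i j → 1 + k ≡ e + e → N ≤ 3 + (k + k) → ¬ RamseyHolds (T (5 + k) i) (T (5 + k) j) N
¬ramsey-even {k} {e} i j 1+k≡2e N≤ = blow-up⇒¬ramsey (five-blocks e) i j (≤-trans N≤ (≤-reflexive total))
  (λ { 0F → inj₂ (here refl , triple) ; 1F → inj₁ pair ; 2F → inj₁ pair
     ; 3F → inj₂ (there (here refl) , triple) ; 4F → inj₁ pair })
  (λ { 0F → inj₁ pair ; 1F → inj₂ (here refl , triple) ; 2F → inj₂ (there (here refl) , triple)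
     ; 3F → inj₁ pair ; 4F → inj₂ (there (there (here refl)) , triple) })
  where
  open ≡-Reasoning
  total : 3 + (k + k) ≡ suc (e + e + e + e)
  total = begin
    3 + (k + k)              ≡⟨ cong (2 +_) (sym (+-suc k k)) ⟩
    suc ((1 + k) + (1 + k))  ≡⟨ cong₂ (λ s t → suc (s + t)) 1+k≡2e 1+k≡2e ⟩
    suc (e + e + (e + e))    ≡⟨ cong suc (sym (+-assoc (e + e) e e)) ⟩
    suc (e + e + e + e)      ∎
  pair : e + (e + 0) ≤ 1 + k
  pair = ≤-reflexive (trans (cong (e +_) (+-identityʳ e)) (sym 1+k≡2e))
  triple : e + (e + 1) ≤ 2 + k
  triple = ≤-reflexive (trans (sym (+-assoc e e 1)) (trans (+-comm (e + e) 1) (cong suc (sym 1+k≡2e))))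

-- From k back to n, and the two parities.

2*[5+k] : ∀ k → 2 * (5 + k) ≡ 10 + (k + k)
2*[5+k] k = cong (5 +_) (begin
  k + (5 + (k + 0))    ≡⟨ cong (λ s → k + (5 + s)) (+-identityʳ k) ⟩
  k + (5 + k)          ≡⟨ sym (+-assoc k 5 k) ⟩
  k + 5 + k            ≡⟨ cong (_+ k) (+-comm k 5) ⟩
  5 + (k + k)          ∎)
  where open ≡-Reasoning

theorem4p1 : (n : ℕ) → (i j : Idx) →
    (¬ (2 ∣ n) → 17 ≤ n → RamseyNumber (T n i) (T n j) (2 * n ∸ 7)) ×
    (2 ∣ n → 12 ≤ n → RamseyNumber (T n i) (T n j) (2 * n ∸ 6))
theorem4p1 n i j = odd-case , even-case
  where
  odd-case : ¬ (2 ∣ n) → 17 ≤ n → RamseyNumber (T n i) (T n j) (2 * n ∸ 7)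
  odd-case odd 17≤n with m≤n⇒∃[o]m+o≡n (≤-trans (m≤m+n 5 12) 17≤n)
  ... | k , refl = subst (RamseyNumber (T (5 + k) i) (T (5 + k) j)) (cong (_∸ 7) (sym (2*[5+k] k)))
      (s≤s z≤n , ramsey-odd i j 7≤k odd ,
       -- Here N < 3 + 2k, so `N` is at most twice the clique size k + 1.
       λ N _ N< → ¬ramsey-odd i j (subst (N ≤_) (cong suc (sym (+-suc k k))) (s≤s⁻¹ N<)))
    where
    7≤k : 7 ≤ k
    7≤k = ≤-trans (m≤m+n 7 5) (+-cancelˡ-≤ 5 12 k 17≤n)
  even-case : 2 ∣ n → 12 ≤ n → RamseyNumber (T n i) (T n j) (2 * n ∸ 6)
  even-case 2∣n 12≤n with m≤n⇒∃[o]m+o≡n (≤-trans (m≤m+n 5 7) 12≤n)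
  -- Evenness of n = 4 + (1 + k) yields 1 + k = 2e, which fixes the block size `e`.
  ... | k , refl with ∣m+n∣m⇒∣n {2} {4} 2∣n (divides 2 refl)
  ...   | divides e 1+k≡e*2 = subst (RamseyNumber (T (5 + k) i) (T (5 + k) j)) (cong (_∸ 6) (sym (2*[5+k] k)))
      (s≤s z≤n , ramsey-even i j (+-cancelˡ-≤ 5 7 k 12≤n) ,
       λ N _ N< → ¬ramsey-even {e = e} i j
         (trans 1+k≡e*2 (trans (*-comm e 2) (cong (e +_) (+-identityʳ e)))) (s≤s⁻¹ N<))
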